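{- There is an $\mathrm{STC{+}C}$-formula $\varphi_D(p,x,z)$, with $p$ a number variable and $x,z$ structure variables, such that for all graphs $G$, all $i\in N(G)=[0,|V(G)|]$ and all vertices $v\in V(G)$, the set $\{w\in V(G)\mid G\models\varphi_D[i,v,w]\}$ equals the set $D_{i,v}$ of the modular decomposition of $G$.
   Context: $\mathrm{STC{+}C}$ is symmetric transitive closure logic with counting, evaluated over two-sorted structures whose number sort is $N(G)=[0,|U(G)|]$ with its natural order. Graphs $G=(V,E)$ are finite simple undirected with $V\neq\emptyset$. A module of $G$ is a non-empty $M\subseteq V$ such that for all $v\in V\setminus M$ and $w,w'\in M$: $\{v,w\}\in E\iff\{v,w'\}\in E$. For $v\in V$: if $|V|=1$ let $D_G(v)=\{v\}$; if $|V|>1$, let $D_G(v)$ be the connected component of $G$ containing $v$ if $G$ is disconnected, the connected component of the complement $\overline G$ containing $v$ if $\overline G$ is disconnected, and otherwise the maximal proper module of $G$ containing $v$ (when $G$ and $\overline G$ are connected, the maximal proper modules partition $V$). With $n=|V|$, the modular decomposition of $G$ is the family $D_{i,v}$ ($i\in[0,n]$, $v\in V$) defined by $D_{0,v}=V$ and $D_{i+1,v}=D_{G[D_{i,v}]}(v)$. -}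

module Defs where

open import Data.Nat using (ℕ; zero; suc; _+_)
open import Data.Fin using (Fin; toℕ) renaming (_≤_ to _≤ᶠ_)
open import Data.Fin.Subset using (Subset; _∈_; _∉_)
open import Data.Bool using (Bool; true; false)
open import Data.Vec using (Vec; []; _∷_; lookup; map; _++_)
open import Data.Product using (Σ; _×_; _,_; ∃)
open import Data.Sum using (_⊎_)
open import Data.Unit using (⊤)
open import Relation.Nullary using (¬_)
open import Relation.Binary.PropositionalEquality using (_≡_; _≢_)
open import Relation.Binary.Construct.Closure.Symmetric using (SymClosure)
open import Relation.Binary.Construct.Closure.ReflexiveTransitive using (Star)
open import Function.Definitions using (Injective)
open import Function.Bundles using (_⇔_)

record Graph : Set where
  field
    n        : ℕ
    nonempty : n ≢ 0
    E        : Fin n → Fin n → Bool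
    E-sym    : ∀ u v → E u v ≡ E v u
    E-irr    : ∀ v → E v v ≡ false

module _ (G : Graph) where
  open Graph G

  V : Set
  V = Fin n

  Num : Set
  Num = Fin (suc n)

  Adj : V → V → Set
  Adj u v = E u v ≡ true

  CoAdj : V → V → Set
  CoAdj u v = (u ≢ v) × (E u v ≡ false)

-- Syntax of STC+C, well-scoped: Formula s m has its free structure
-- variables among Fin s and its free number variables among Fin m.

data Formula : ℕ → ℕ → Set where
  eqS  : ∀ {s m} → Fin s → Fin s → Formula s m
  edge : ∀ {s m} → Fin s → Fin s → Formula s m
  eqN  : ∀ {s m} → Fin m → Fin m → Formula s m
  leN  : ∀ {s m} → Fin m → Fin m → Formula s m
  neg  : ∀ {s m} → Formula s m → Formula s m
  and  : ∀ {s m} → Formula s m → Formula s m → Formula s m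
  or   : ∀ {s m} → Formula s m → Formula s m → Formula s m
  exS  : ∀ {s m} → Formula (suc s) m → Formula s m
  exN  : ∀ {s m} → Formula s (suc m) → Formula s m
  cntS : ∀ {s m} → Formula (suc s) m → Fin m → Formula s m
  cntN : ∀ {s m} → Formula s (suc m) → Fin m → Formula s m
  -- symmetric transitive closure over tuples consisting of k structure
  -- and l number components:  [stc_{(x̄,p̄),(ȳ,q̄)} φ] ((ū,r̄),(v̄,t̄)).
  -- In φ the structure variables are  x̄ ++ ȳ ++ (outer), and the
  -- number variables are  p̄ ++ q̄ ++ (outer).
  stc  : ∀ {s m} (k l : ℕ) → Formula (k + (k + s)) (l + (l + m)) →
         Vec (Fin s) k → Vec (Fin m) l →
         Vec (Fin s) k → Vec (Fin m) l → Formula s m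

module _ (G : Graph) where
  open Graph G

  AtLeast : (A : Set) → ℕ → (A → Set) → Set
  AtLeast A c P = Σ (Fin c → A) λ f → Injective _≡_ _≡_ f × (∀ j → P (f j))

  Sat : ∀ {s m} → Formula s m → Vec (V G) s → Vec (Num G) m → Set
  Sat (eqS x y)  σ τ = lookup σ x ≡ lookup σ y
  Sat (edge x y) σ τ = Adj G (lookup σ x) (lookup σ y)
  Sat (eqN p q)  σ τ = lookup τ p ≡ lookup τ q
  Sat (leN p q)  σ τ = lookup τ p ≤ᶠ lookup τ q
  Sat (neg φ)    σ τ = ¬ Sat φ σ τ
  Sat (and φ ψ)  σ τ = Sat φ σ τ × Sat ψ σ τ
  Sat (or φ ψ)   σ τ = Sat φ σ τ ⊎ Sat ψ σ τ
  Sat (exS φ)    σ τ = Σ (V G) λ a → Sat φ (a ∷ σ) τ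
  Sat (exN φ)    σ τ = Σ (Num G) λ a → Sat φ σ (a ∷ τ)
  Sat (cntS φ p) σ τ = AtLeast (V G) (toℕ (lookup τ p)) (λ a → Sat φ (a ∷ σ) τ)
  Sat (cntN φ p) σ τ = AtLeast (Num G) (toℕ (lookup τ p)) (λ a → Sat φ σ (a ∷ τ))
  Sat (stc k l φ us ps vs qs) σ τ =
    Star (SymClosure R) (map (lookup σ) us , map (lookup τ) ps)
                        (map (lookup σ) vs , map (lookup τ) qs)
    where
      R : Vec (V G) k × Vec (Num G) l → Vec (V G) k × Vec (Num G) l → Set
      R (a , p) (b , q) = Sat φ (a ++ (b ++ σ)) (p ++ (q ++ τ))

-- Modular decomposition.  Vertex sets of induced subgraphs G[U] are
-- given as predicates U : V → Set.

module _ (G : Graph) where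
  open Graph G

  ConnIn : (V G → Set) → V G → V G → Set
  ConnIn U v w = U v × U w × Star (λ a b → U a × U b × Adj G a b) v w

  CoConnIn : (V G → Set) → V G → V G → Set
  CoConnIn U v w = U v × U w × Star (λ a b → U a × U b × CoAdj G a b) v w

  Disconnected : (V G → Set) → Set
  Disconnected U = Σ (V G) λ a → Σ (V G) λ b → U a × U b × ¬ ConnIn U a b

  CoDisconnected : (V G → Set) → Set
  CoDisconnected U = Σ (V G) λ a → Σ (V G) λ b → U a × U b × ¬ CoConnIn U a b

  Singleton : (V G → Set) → Set
  Singleton U = Σ (V G) λ u → U u × (∀ x → U x → x ≡ u)

  AtLeastTwo : (V G → Set) → Set
  AtLeastTwo U = Σ (V G) λ a → Σ (V G) λ b → U a × U b × a ≢ b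

  IsModule : (V G → Set) → Subset n → Set
  IsModule U M =
    (∀ x → x ∈ M → U x) ×
    (Σ (V G) λ x → x ∈ M) ×
    (∀ x w w' → U x → x ∉ M → w ∈ M → w' ∈ M → (Adj G x w ⇔ Adj G x w'))

  IsProperModule : (V G → Set) → Subset n → Set
  IsProperModule U M = IsModule U M × (Σ (V G) λ x → U x × x ∉ M)

  IsMaximalProperModule : (V G → Set) → Subset n → Set
  IsMaximalProperModule U M =
    IsProperModule U M ×
    (∀ M' → IsProperModule U M' → (∀ x → x ∈ M → x ∈ M') → ∀ x → x ∈ M' → x ∈ M)

  InD : (V G → Set) → V G → V G → Set
  InD U v w =
    (Singleton U × w ≡ v)
    ⊎ (AtLeastTwo U × Disconnected U × ConnIn U v w)
    ⊎ (AtLeastTwo U × CoDisconnected U × CoConnIn U v w)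
    ⊎ (AtLeastTwo U × ¬ Disconnected U × ¬ CoDisconnected U ×
       Σ (Subset n) λ M → IsMaximalProperModule U M × v ∈ M × w ∈ M)

  InDecomp : ℕ → V G → V G → Set
  InDecomp zero    v w = ⊤
  InDecomp (suc i) v w = InD (InDecomp i v) v w

{-# OPTIONS --safe #-}
module Submission where

-- Let span v u be the least module containing v and u. By Gallai it is the
-- set of vertices covered by the class of the pair (v,u) under the symmetric
-- relation "(a,b) ~ (a,d) when ab and ad have the same type and bd the other
-- one", so it is definable with stc. Put  a <_v b  when  span v a ⊊ span v b.
-- Then  D_{i+1,v} = {v} ∪ {w | w <_v u for some u ∈ D_{i,v}},  so for w ≠ v
-- membership in D_{i,v} means that an ascending <_v-chain of length i starts
-- at w. Taking only covering steps a ⋖ b with a ≠ v, each of which lowers a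
-- number by one, membership of a in D_{p,v} is invariant in both directions,
-- and a symmetric transitive closure detects the chain.

open import Defs
open import Data.Nat using (ℕ; zero; suc; z≤n)
import Data.Nat as ℕ
import Data.Nat.Properties as ℕ
open import Data.Fin using (Fin; zero; suc; toℕ; fromℕ<; inject₁)
open import Data.Fin.Properties using (_≟_; any?; toℕ<n; toℕ-fromℕ<; toℕ-inject₁)
open import Data.Fin.Induction using (spo-wellFounded)
open import Data.Fin.Subset using (Subset; _∈_; _∉_)
open import Data.Fin.Subset.Properties using (_∈?_)
open import Data.Bool using (Bool; true; false; not)
import Data.Bool.Properties as Bool
open import Data.Vec using (Vec; []; _∷_; _++_; lookup; tabulate)
open import Data.Vec.Properties using (lookup∘tabulate; lookup⇒[]=; []=⇒lookup)
open import Data.List using (List; []; _∷_; allFin; cartesianProduct; filter)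
open import Data.List.Membership.Propositional using () renaming (_∈_ to _∈ᴸ_)
open import Data.List.Membership.Propositional.Properties
  using (∈-allFin; ∈-cartesianProduct⁺; ∈-filter⁺)
open import Data.List.Relation.Unary.All using (All; []; _∷_)
open import Data.List.Relation.Unary.All.Properties using (all-filter)
open import Data.List.Relation.Unary.Any using (here; there)
open import Data.Product using (Σ; ∃; _×_; _,_; proj₁; proj₂)
open import Data.Product.Properties using (≡-dec)
open import Data.Sum using (_⊎_; inj₁; inj₂)
open import Data.Empty using (⊥; ⊥-elim)
open import Data.Unit using (tt)
open import Function using (_∘_; id)
open import Function.Bundles using (_⇔_; mk⇔; module Equivalence)
open import Induction.WellFounded using (Acc; acc)
open import Relation.Nullary using (¬_; Dec; yes; no; does; contradiction)
open import Relation.Nullary.Decidable using (_×-dec_; _⊎-dec_; ¬?; map′; decidable-stable; dec-true)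
open import Relation.Binary using (Decidable; DecidableEquality; IsStrictPartialOrder; Symmetric; Transitive)
open import Relation.Binary.Construct.Closure.Symmetric using (SymClosure; fwd; bwd)
open import Relation.Binary.Construct.Closure.ReflexiveTransitive as Star using (Star; ε; _◅_; _◅◅_)
open import Relation.Binary.PropositionalEquality
  using (_≡_; _≢_; refl; sym; trans; cong; subst; ≢-sym; isEquivalence; module ≡-Reasoning)
import Relation.Unary as Unary

open Equivalence using (to; from)

-- Decidability of reachability in a finite relation.

module Reachability {A : Set} {R : A → A → Set} (R? : Decidable R) (_≟ᴬ_ : DecidableEquality A) where

  -- Warshall: all intermediate points of the path lie in the list.
  Via : List A → A → A → Set
  Via []       a b = a ≡ b ⊎ R a b
  Via (x ∷ xs) a b = Via xs a b ⊎ (Via xs a x × Via xs x b)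

  via? : ∀ xs → Decidable (Via xs)
  via? []       a b = (a ≟ᴬ b) ⊎-dec R? a b
  via? (x ∷ xs) a b = via? xs a b ⊎-dec (via? xs a x ×-dec via? xs x b)

  via⇒star : ∀ xs {a b} → Via xs a b → Star R a b
  via⇒star []       (inj₁ refl)    = ε
  via⇒star []       (inj₂ r)       = r ◅ ε
  via⇒star (x ∷ xs) (inj₁ p)       = via⇒star xs p
  via⇒star (x ∷ xs) (inj₂ (p , q)) = via⇒star xs p ◅◅ via⇒star xs q

  via-[] : ∀ xs {a b} → Via [] a b → Via xs a b
  via-[] []       p = p
  via-[] (x ∷ xs) p = inj₁ (via-[] xs p)

  -- Induction on the position of `x` in the list. If both pieces pass through the pivot, the loop
  -- between the two visits is cut out.
  via-trans : ∀ {xs x a b} → x ∈ᴸ xs → Via xs a x → Via xs x b → Via xs a b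
  via-trans (here refl) (inj₁ p)       (inj₁ q)       = inj₂ (p , q)
  via-trans (here refl) (inj₁ p)       (inj₂ (_ , q)) = inj₂ (p , q)
  via-trans (here refl) (inj₂ (p , _)) (inj₁ q)       = inj₂ (p , q)
  via-trans (here refl) (inj₂ (p , _)) (inj₂ (_ , q)) = inj₂ (p , q)
  via-trans (there i)   (inj₁ p)       (inj₁ q)       = inj₁ (via-trans i p q)
  via-trans (there i)   (inj₁ p)       (inj₂ (q , r)) = inj₂ (via-trans i p q , r)
  via-trans (there i)   (inj₂ (p , q)) (inj₁ r)       = inj₂ (p , via-trans i q r)
  via-trans (there i)   (inj₂ (p , _)) (inj₂ (_ , r)) = inj₂ (p , r)

  star⇒via : ∀ {xs} → (∀ x → x ∈ᴸ xs) → ∀ {a b} → Star R a b → Via xs a b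
  star⇒via {xs} complete ε       = via-[] xs (inj₁ refl)
  star⇒via {xs} complete (r ◅ s) =
    via-trans (complete _) (via-[] xs (inj₂ r)) (star⇒via complete s)

  star? : ∀ {xs} → (∀ x → x ∈ᴸ xs) → Decidable (Star R)
  star? {xs} complete a b = map′ (via⇒star xs) (star⇒via complete) (via? xs a b)

-- Booleans and decidable subsets.

≢-≢⇒≡ : ∀ {x y z : Bool} → x ≢ z → y ≢ z → x ≡ y
≢-≢⇒≡ x≢z y≢z = trans (Bool.¬-not x≢z) (sym (Bool.¬-not y≢z))

module _ {n : ℕ} {P : Fin n → Set} (P? : Unary.Decidable P) where

  toSubset : Subset n
  toSubset = tabulate (does ∘ P?)

  ∈-toSubset⁺ : ∀ {x} → P x → x ∈ toSubset
  ∈-toSubset⁺ {x} px =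
    lookup⇒[]= x toSubset (trans (lookup∘tabulate (does ∘ P?) x) (dec-true (P? x) px))

  ∈-toSubset⁻ : ∀ {x} → x ∈ toSubset → P x
  ∈-toSubset⁻ {x} x∈ with P? x | trans (sym (lookup∘tabulate (does ∘ P?) x)) ([]=⇒lookup x∈)
  ... | yes px | _  = px
  ... | no _   | ()

-- Modules, the forcing relation on pairs, and the modules generated by two vertices.

module Spans (G : Graph) where
  open Graph G

  Module : (V G → Set) → Set
  Module X = ∀ {x a b} → ¬ X x → X a → X b → E x a ≡ E x b

  -- `¬ Adj` also admits equal vertices, but coincidences are harmless: each one is contradictory or
  -- leaves the trivial step with `b` equal to `d`.
  SameType : V G → V G → V G → Set
  SameType a b d = (Adj G a b × Adj G a d × ¬ Adj G b d) ⊎ (¬ Adj G a b × ¬ Adj G a d × Adj G b d)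

  -- The first alternative reverses a pair, so every vertex covered by a class occurs as a first
  -- coordinate; `Span` therefore inspects only these.
  Γ : V G × V G → V G × V G → Set
  Γ (a , b) (c , d) = (a ≡ d × b ≡ c) ⊎ (a ≡ c × SameType a b d)

  Span : V G → V G → V G → Set
  Span v u x = ∃ λ y → Star Γ (v , u) (x , y)

  adj? : Decidable (Adj G)
  adj? a b = E a b Bool.≟ true

  adj-sym : ∀ {a b} → Adj G a b → Adj G b a
  adj-sym {a} {b} = trans (E-sym b a)

  Γ? : Decidable Γ
  Γ? (a , b) (c , d) = ((a ≟ d) ×-dec (b ≟ c)) ⊎-dec ((a ≟ c) ×-dec
    ((adj? a b ×-dec (adj? a d ×-dec ¬? (adj? b d))) ⊎-dec
     (¬? (adj? a b) ×-dec (¬? (adj? a d) ×-dec adj? b d))))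

  Γ-sym : Symmetric Γ
  Γ-sym (inj₁ (refl , refl))                       = inj₁ (refl , refl)
  Γ-sym (inj₂ (refl , inj₁ (ab , ad , ¬bd)))  = inj₂ (refl , inj₁ (ad , ab , ¬bd ∘ adj-sym))
  Γ-sym (inj₂ (refl , inj₂ (¬ab , ¬ad , bd))) = inj₂ (refl , inj₂ (¬ad , ¬ab , adj-sym bd))

  span? : ∀ v u → Unary.Decidable (Span v u)
  span? v u x = any? λ y → star? pairs (v , u) (x , y)
    where
    open Reachability Γ? (≡-dec _≟_ _≟_)
    pairs : ∀ p → p ∈ᴸ cartesianProduct (allFin n) (allFin n)
    pairs (a , b) = ∈-cartesianProduct⁺ (∈-allFin a) (∈-allFin b)

  span-left : ∀ v u → Span v u v
  span-left v u = u , ε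

  span-right : ∀ v u → Span v u u
  span-right v u = v , inj₁ (refl , refl) ◅ ε

  -- The pairs `xc` and `xd` have different types, so `cd` shares its type with exactly one of them;
  -- keeping that common vertex leads from `cd` to `x`.
  sameType-or-swap : ∀ {x c d} → E x c ≢ E x d → SameType c d x ⊎ SameType d c x
  sameType-or-swap {x} {c} {d} xc≢xd
    rewrite E-sym d c | E-sym c x | E-sym d x with E x c | E x d | E c d
  ... | true  | true  | _     = contradiction refl xc≢xd
  ... | false | false | _     = contradiction refl xc≢xd
  ... | true  | false | true  = inj₁ (inj₁ (refl , refl , λ ()))
  ... | true  | false | false = inj₂ (inj₂ ((λ ()) , (λ ()) , refl))
  ... | false | true  | true  = inj₂ (inj₁ (refl , refl , λ ()))
  ... | false | true  | false = inj₁ (inj₂ ((λ ()) , (λ ()) , refl))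

  unreached-not-splitting : ∀ {x c d} → ¬ Span c d x → E x c ≡ E x d
  unreached-not-splitting {x} {c} {d} x∉ =
    decidable-stable (E x c Bool.≟ E x d) λ xc≢xd → case-split (sameType-or-swap xc≢xd)
    where
    case-split : SameType c d x ⊎ SameType d c x → ⊥
    case-split (inj₁ s) = x∉ (_ , inj₂ (refl , s) ◅ inj₁ (refl , refl) ◅ ε)
    case-split (inj₂ s) =
      x∉ (_ , inj₁ (refl , refl) ◅ inj₂ (refl , s) ◅ inj₁ (refl , refl) ◅ ε)

  -- Only reversals change the first coordinate, and there `x` sees both ends alike because it is
  -- not reached from that pair.
  constant-along : ∀ {x p q} → (∀ y → ¬ Star Γ p (x , y)) → Star Γ p q → E x (proj₁ p) ≡ E x (proj₁ q)
  constant-along x∉ ε = refl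
  constant-along x∉ (r@(inj₁ (refl , refl)) ◅ s) =
    trans (unreached-not-splitting λ (y , t) → x∉ y t) (constant-along (λ y t → x∉ y (r ◅ t)) s)
  constant-along x∉ (r@(inj₂ (refl , _)) ◅ s) = constant-along (λ y t → x∉ y (r ◅ t)) s

  span-module : ∀ v u → Module (Span v u)
  span-module v u x∉ (_ , s) (_ , t) =
    trans (sym (constant-along (λ y p → x∉ (y , p)) s)) (constant-along (λ y p → x∉ (y , p)) t)

  span-least : ∀ {X} → Unary.Decidable X → Module X → ∀ {v u} → X v → X u → ∀ {x} → Span v u x → X x
  span-least {X} X? mod Xv Xu (_ , s) = go s Xv Xu
    where
    distinguished : ∀ {a b d} → SameType a b d → E d a ≢ E d b
    distinguished {a} {b} {d} (inj₁ (ab , ad , ¬bd)) eq = ¬bd (adj-sym (trans (sym eq) (adj-sym ad)))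
    distinguished {a} {b} {d} (inj₂ (¬ab , ¬ad , bd)) eq = ¬ad (adj-sym (trans eq (adj-sym bd)))

    go : ∀ {a b c d} → Star Γ (a , b) (c , d) → X a → X b → X c
    go ε Xa Xb = Xa
    go (inj₁ (refl , refl) ◅ s) Xa Xb = go s Xb Xa
    -- The new vertex `d` distinguishes two elements of the module `X`, so it cannot lie outside
    -- `X`.
    go (inj₂ (refl , st) ◅ s)   Xa Xb =
      go s Xa (decidable-stable (X? _) λ ¬Xd → distinguished st (mod ¬Xd Xa Xb))

  span-mono : ∀ {v a b x} → Span v b a → Span v a x → Span v b x
  span-mono {v} {b = b} b∋a = span-least (span? v b) (span-module v b) (span-left v b) b∋a

  span-self : ∀ {v x} → Span v v x → x ≡ v
  span-self {v} = span-least (_≟ v) (λ { _ refl refl → refl }) refl refl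

  module-∪ : ∀ {X Y v} → Module X → Module Y → X v → Y v → Module (λ x → X x ⊎ Y x)
  module-∪ {X} {Y} {v} modX modY Xv Yv x∉ Za Zb = trans (toV Za) (sym (toV Zb))
    where
    toV : ∀ {a} → X a ⊎ Y a → E _ a ≡ E _ v
    toV (inj₁ Xa) = modX (x∉ ∘ inj₁) Xa Xv
    toV (inj₂ Ya) = modY (x∉ ∘ inj₂) Ya Yv

  -- By `span-mono`, membership of one generator already encodes inclusion of the spans, so this is
  -- strict inclusion.
  Below : V G → V G → V G → Set
  Below v a b = Span v b a × ¬ Span v a b

  below? : ∀ v → Decidable (Below v)
  below? v a b = span? v b a ×-dec ¬? (span? v a b)

  below-trans : ∀ {v} → Transitive (Below v)
  below-trans (a∈ , _) (b∈ , c∉) = span-mono b∈ a∈ , c∉ ∘ λ c∈ → span-mono a∈ c∈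

  ¬below-bottom : ∀ {v a} → ¬ Below v a v
  ¬below-bottom (a∈ , v∉) = v∉ (span-left _ _)

  below-isStrictPartialOrder : ∀ v → IsStrictPartialOrder _≡_ (Below v)
  below-isStrictPartialOrder v = record
    { isEquivalence = isEquivalence
    ; irrefl        = λ { refl (a∈ , a∉) → a∉ a∈ }
    ; trans         = below-trans
    ; <-resp-≈      = (λ { refl → id }) , λ { refl → id }
    }

  Cover : V G → V G → V G → Set
  Cover v a b = Below v a b × ¬ ∃ λ y → Below v a y × Below v y b

  -- Well-founded descent on the upper end: replace `b` by a vertex strictly in between until there
  -- is none.
  exists-cover : ∀ {v a b} → Below v a b → ∃ λ c → Cover v a c
  exists-cover {v} {a} {b} = go (spo-wellFounded (below-isStrictPartialOrder v) b)
    where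
    go : ∀ {b} → Acc (Below v) b → Below v a b → ∃ λ c → Cover v a c
    go {b} (acc rec) a<b with any? (λ y → below? v a y ×-dec below? v y b)
    ... | yes (y , a<y , y<b) = go (rec y<b) a<y
    ... | no none             = b , a<b , none

-- One decomposition step, expressed through the order of spans.

module Layers (G : Graph) (v : V G) where
  open Graph G
  open Spans G

  -- The invariant of the layers around `v`. As `U` is a module of the whole graph, spans formed in
  -- `G` from `v` and a point of `U` stay inside `U`, so no relativised spans are required.
  record Good (U : V G → Set) : Set where
    field
      centre : U v
      U?     : Unary.Decidable U
      mod    : Module U

  Edge : Bool → V G → V G → Set
  Edge true  = Adj G
  Edge false = CoAdj G

  edge⁻ : ∀ β {a b} → Edge β a b → a ≢ b × E a b ≡ β
  edge⁻ true  e = (λ { refl → contradiction (trans (sym e) (E-irr _)) λ () }) , e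
  edge⁻ false e = e

  edge⁺ : ∀ β {a b} → a ≢ b → E a b ≡ β → Edge β a b
  edge⁺ true  _  e = e
  edge⁺ false ne e = ne , e

  edge-sym : ∀ β → Symmetric (Edge β)
  edge-sym β e with edge⁻ β e
  ... | ne , eq = edge⁺ β (≢-sym ne) (trans (E-sym _ _) eq)

  edge? : ∀ β → Decidable (Edge β)
  edge? true  a b = adj? a b
  edge? false a b = ¬? (a ≟ b) ×-dec (E a b Bool.≟ false)

  Step : Bool → (V G → Set) → V G → V G → Set
  Step β U a b = U a × U b × Edge β a b

  -- Conn true and Conn false are ConnIn G and CoConnIn G, and Disc likewise, definitionally.
  Conn : Bool → (V G → Set) → V G → V G → Set
  Conn β U a b = U a × U b × Star (Step β U) a b

  Disc : Bool → (V G → Set) → Set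
  Disc β U = ∃ λ a → ∃ λ b → U a × U b × ¬ Conn β U a b

  ¬disc-both : ∀ {U} → ¬ Disconnected G U → ¬ CoDisconnected G U → ∀ β → ¬ Disc β U
  ¬disc-both ¬disc ¬codisc true  = ¬disc
  ¬disc-both ¬disc ¬codisc false = ¬codisc

  -- The order-theoretic candidate for the next layer. The first alternative supplies `v` when `U`
  -- is a singleton and no `u` lies above it.
  Next : (V G → Set) → V G → Set
  Next U w = w ≡ v ⊎ ∃ λ u → U u × Below v w u

  module OneStep {U : V G → Set} (good : Good U) where
    open Good good

    span⊆ : ∀ {u} → U u → ∀ {x} → Span v u x → U x
    span⊆ = span-least U? mod centre

    next? : Unary.Decidable (Next U)
    next? w = (w ≟ v) ⊎-dec any? λ u → U? u ×-dec below? v w u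

    next-module : Module (Next U)
    next-module {x} x∉ Na Nb = trans (toV Na) (sym (toV Nb))
      where
      toV : ∀ {a} → Next U a → E x a ≡ E x v
      toV (inj₁ refl) = refl
      toV {a} (inj₂ (u , Uu , a∈ , u∉)) =
        -- If `x` lay in the span of `v` and `a`, its own span with `v` would be contained there,
        -- hence strictly below that of `u`, and `x` would be in `Next U`.
        span-module v a (λ x∈ → x∉ (inj₂ (u , Uu , span-mono a∈ x∈ , λ u∈ → u∉ (span-mono x∈ u∈))))
          (span-right v a) (span-left v a)

    next-⊆ : ∀ {w} → Next U w → U w
    next-⊆ (inj₁ refl)              = centre
    next-⊆ (inj₂ (u , Uu , w∈ , _)) = span⊆ Uu w∈

    -- Components of the graph or of its complement, restricted to `U`.

    module Connectivity (β : Bool) where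

      conn? : Decidable (Conn β U)
      conn? a b = U? a ×-dec (U? b ×-dec star? ∈-allFin a b)
        where open Reachability (λ a b → U? a ×-dec (U? b ×-dec edge? β a b)) _≟_

      disc? : Dec (Disc β U)
      disc? = any? λ a → any? λ b → U? a ×-dec (U? b ×-dec ¬? (conn? a b))

      conn-refl : ∀ {a} → U a → Conn β U a a
      conn-refl Ua = Ua , Ua , ε

      conn-sym : Symmetric (Conn β U)
      conn-sym (Ua , Ub , s) =
        Ub , Ua , Star.reverse (λ (Ux , Uy , e) → Uy , Ux , edge-sym β e) s

      conn-trans : Transitive (Conn β U)
      conn-trans (Ua , _ , s) (_ , Uc , t) = Ua , Uc , s ◅◅ t

      conn-step : ∀ {a b} → U a → U b → Edge β a b → Conn β U a b
      conn-step Ua Ub e = Ua , Ub , (Ua , Ub , e) ◅ ε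

      -- A vertex of the component outside X sees its neighbour in X, hence also u.
      component⊆ : ∀ {X} → Unary.Decidable X → Module X → ∀ {u} → U u → X u →
                   ∀ {a w} → ¬ Conn β U a u → X a → Conn β U a w → X w
      component⊆ {X} X? modX {u} Uu Xu = λ a≁u Xa (_ , _ , s) → go a≁u Xa s
        where
        go : ∀ {a w} → ¬ Conn β U a u → X a → Star (Step β U) a w → X w
        go a≁u Xa ε = Xa
        go {a} a≁u Xa (_◅_ {j = b} (Ua , Ub , e) s) with X? b
        ... | yes Xb = go (a≁u ∘ conn-trans (conn-step Ua Ub e)) Xb s
        ... | no ¬Xb = ⊥-elim (a≁u (conn-trans (conn-step Ua Ub e) (conn-step Ub Uu
                         (edge⁺ β (λ { refl → ¬Xb Xu })
                           (trans (modX ¬Xb Xu Xa) (proj₂ (edge⁻ β (edge-sym β e))))))))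

      -- A vertex of `U` outside `X` has no `β`-edge into `X`, so it sees all of `X` with the other
      -- type; a vertex outside `U` sees it uniformly because `U` is a module.
      closed-module : ∀ {X} → (∀ {x} → X x → U x) →
                      (∀ {x y} → X x → U y → Edge β x y → X y) → Module X
      closed-module {X} X⊆U closed {x} {a} {b} ¬Xx Xa Xb with U? x
      ... | no ¬Ux = mod ¬Ux (X⊆U Xa) (X⊆U Xb)
      ... | yes Ux = ≢-≢⇒≡ (outside Xa) (outside Xb)
        where
        outside : ∀ {y} → X y → E x y ≢ β
        outside Xy eq =
          ¬Xx (closed Xy Ux (edge-sym β (edge⁺ β (λ { refl → ¬Xx Xy }) eq)))

      component-module : ∀ {a} → Module (Conn β U a)
      component-module = closed-module (proj₁ ∘ proj₂)
        λ c Uy e → conn-trans c (conn-step (proj₁ (proj₂ c)) Uy e)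

      two-components-module : ∀ {a b} → Module (λ x → Conn β U a x ⊎ Conn β U b x)
      two-components-module = closed-module
        (λ { (inj₁ c) → proj₁ (proj₂ c) ; (inj₂ c) → proj₁ (proj₂ c) })
        λ { (inj₁ c) Uy e → inj₁ (conn-trans c (conn-step (proj₁ (proj₂ c)) Uy e))
          ; (inj₂ c) Uy e → inj₂ (conn-trans c (conn-step (proj₁ (proj₂ c)) Uy e)) }

      -- By `component⊆`, the span reaching from `v` to the other component swallows the component
      -- of `v`. Conversely that component is a module, so it contains the span of `v` and `w` and
      -- keeps `u` out.
      separated⇒below : ∀ {u w} → U u → ¬ Conn β U v u → Conn β U v w → Below v w u
      separated⇒below {u} {w} Uu v≁u v~w =
        component⊆ (span? v u) (span-module v u) Uu (span-right v u) v≁u (span-left v u) v~w ,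
        v≁u ∘ span-least (conn? v) component-module (conn-refl centre) v~w

      disc⇒next : Disc β U → ∀ {w} → Conn β U v w → Next U w
      -- Of two mutually unreachable points, at least one misses the component of `v` and can serve
      -- as the upper vertex.
      disc⇒next (a , b , Ua , Ub , a≁b) v~w with conn? v a
      ... | no v≁a  = inj₂ (a , Ua , separated⇒below Ua v≁a v~w)
      ... | yes v~a = inj₂ (b , Ub , separated⇒below Ub (a≁b ∘ conn-trans (conn-sym v~a)) v~w)

      next⇒conn : ∀ {w} → Next U w → Conn β U v w
      next⇒conn (inj₁ refl) = conn-refl centre
      next⇒conn {w} N@(inj₂ (u , Uu , w∈ , u∉)) with conn? v w
      ... | yes v~w = v~w
      -- The components of `v` and `u` together form a module containing the span of `v` and `u`, so
      -- `w` is in the component of `u`. That component avoids `v`, hence is swallowed by the span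
      -- of `v` and `w`, which then contains `u`.
      ... | no v≁w  = ⊥-elim (u∉ (into
              (span-least (λ x → conn? v x ⊎-dec conn? u x) two-components-module
                (inj₁ (conn-refl centre)) (inj₂ (conn-refl Uu)) w∈)))
        where
        into : Conn β U v w ⊎ Conn β U u w → Span v w u
        into (inj₁ v~w) = contradiction v~w v≁w
        into (inj₂ u~w) = component⊆ (span? v w) (span-module v w) centre (span-left v w)
          (v≁w ∘ conn-sym) (span-right v w) (conn-sym u~w)

    -- The case where `U` is connected in the graph and in its complement.

    module Prime (¬disc : ∀ β → ¬ Disc β U) where

      -- If X and Y covered U, all pairs between X \ Y and Y would have the type
      -- of q p, and no path of the other type would lead from q to p.
      modules-leave-gap : ∀ {X Y} → Unary.Decidable X → Unary.Decidable Y → Module X → Module Y →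
        ∀ {p q} → U p → ¬ X p → U q → ¬ Y q → ∃ λ y → U y × ¬ X y × ¬ Y y
      modules-leave-gap {X} {Y} X? Y? modX modY {p} {q} Up ¬Xp Uq ¬Yq
        with any? (λ y → U? y ×-dec (¬? (X? y) ×-dec ¬? (Y? y)))
      ... | yes gap = gap
      ... | no full = ⊥-elim (¬disc (not β) (q , p , Uq , Up , λ (_ , _ , s) → no-path ¬Yq s))
        where
        β = E q p

        inX : ∀ {x} → U x → ¬ Y x → X x
        inX Ux ¬Yx = decidable-stable (X? _) λ ¬Xx → full (_ , Ux , ¬Xx , ¬Yx)

        Yp : Y p
        Yp = decidable-stable (Y? p) λ ¬Yp → ¬Xp (inX Up ¬Yp)

        uniform : ∀ {x y} → U x → ¬ Y x → Y y → E x y ≡ β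
        uniform {x} {y} Ux ¬Yx Yy = begin
          E x y ≡⟨ modY ¬Yx Yy Yp ⟩
          E x p ≡⟨ E-sym x p ⟩
          E p x ≡⟨ modX ¬Xp (inX Ux ¬Yx) (inX Uq ¬Yq) ⟩
          E p q ≡⟨ E-sym p q ⟩
          E q p ∎
          where open ≡-Reasoning

        no-path : ∀ {a} → ¬ Y a → ¬ Star (Step (not β) U) a p
        no-path ¬Ya ε = ¬Ya Yp
        no-path ¬Ya ((Ua , Ub , e) ◅ s) = no-path
          (λ Yb → Bool.not-¬ (uniform Ua ¬Ya Yb) (proj₂ (edge⁻ (not β) e))) s

      subset-module : ∀ {M} → IsModule G U M → Module (_∈ M)
      subset-module (M⊆U , _ , same) {x} {a} {b} x∉ a∈ b∈ with U? x
      ... | no ¬Ux = mod ¬Ux (M⊆U a a∈) (M⊆U b b∈)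
      ... | yes Ux with E x a | E x b | same x a b Ux x∉ a∈ b∈
      ...   | true  | _     | eqv = sym (to eqv refl)
      ...   | false | false | _   = refl
      ...   | false | true  | eqv = from eqv refl

      module-subset : ∀ {X} (X? : Unary.Decidable X) → (∀ {x} → X x → U x) → X v → Module X →
                      IsModule G U (toSubset X?)
      module-subset X? X⊆U Xv modX =
        (λ x x∈ → X⊆U (∈-toSubset⁻ X? x∈)) ,
        (v , ∈-toSubset⁺ X? Xv) ,
        λ x w w' Ux x∉ w∈ w'∈ →
          let eq = modX (x∉ ∘ ∈-toSubset⁺ X?) (∈-toSubset⁻ X? w∈) (∈-toSubset⁻ X? w'∈)
          in mk⇔ (trans (sym eq)) (trans eq)

      -- If the span of `v` and `u` missed `w`, it and `M` would leave a gap in `U`; their union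
      -- would be a proper module containing `M` and `u`, against maximality. Conversely the span of
      -- `v` and `w` stays in `M`.
      separated⇒below : ∀ {M} → IsMaximalProperModule G U M → v ∈ M →
                        ∀ {u w} → U u → u ∉ M → w ∈ M → Below v w u
      separated⇒below {M} ((isMod , _) , maximal) v∈ {u} {w} Uu u∉ w∈ =
        decidable-stable (span? v u w) ¬¬w∈span ,
        u∉ ∘ span-least (_∈? M) (subset-module isMod) v∈ w∈
        where
        M⊆U = proj₁ isMod
        ∪? : Unary.Decidable (λ x → x ∈ M ⊎ Span v u x)
        ∪? x = (x ∈? M) ⊎-dec span? v u x
        ¬¬w∈span : ¬ ¬ Span v u w
        ¬¬w∈span w∉ with modules-leave-gap (_∈? M) (span? v u) (subset-module isMod)
                           (span-module v u) Uu u∉ (M⊆U w w∈) w∉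
        ... | y , Uy , y∉M , y∉span = u∉ (maximal (toSubset ∪?)
                ( module-subset ∪? (λ { (inj₁ x∈) → M⊆U _ x∈ ; (inj₂ x∈) → span⊆ Uu x∈ }) (inj₁ v∈)
                    (module-∪ (subset-module isMod) (span-module v u) v∈ (span-left v u))
                , y , Uy , λ y∈ → case (∈-toSubset⁻ ∪? y∈))
                (λ x x∈ → ∈-toSubset⁺ ∪? (inj₁ x∈)) u (∈-toSubset⁺ ∪? (inj₂ (span-right v u))))
          where
          case : y ∈ M ⊎ Span v u y → ⊥
          case (inj₁ y∈) = y∉M y∈
          case (inj₂ y∈) = y∉span y∈

      maximal⇒next : ∀ {M w} → IsMaximalProperModule G U M → v ∈ M → w ∈ M → Next U w
      maximal⇒next isMax@((_ , u , Uu , u∉) , _) v∈ w∈ =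
        inj₂ (u , Uu , separated⇒below isMax v∈ Uu u∉ w∈)

      -- When `U` has a point besides `v`, this is the maximal proper module containing `v`: the
      -- union of all spans through `v` that do not exhaust `U`.
      Block : V G → Set
      Block x = U x × ∃ λ y → U y × ¬ Span v x y

      block? : Unary.Decidable Block
      block? x = U? x ×-dec any? λ y → U? y ×-dec ¬? (span? v x y)

      module _ {t} (Ut : U t) (t≢v : t ≢ v) where

        next⇒block : ∀ {w} → Next U w → Block w
        next⇒block (inj₁ refl)               = centre , t , Ut , t≢v ∘ span-self
        next⇒block (inj₂ (u , Uu , w∈ , u∉)) = span⊆ Uu w∈ , u , Uu , u∉

        v∈block : Block v
        v∈block = next⇒block (inj₁ refl)

        Spans⋃ : List (V G) → V G → Set
        Spans⋃ []       w = w ≡ v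
        Spans⋃ (x ∷ xs) w = Spans⋃ xs w ⊎ Span v x w

        spans⋃? : ∀ xs → Unary.Decidable (Spans⋃ xs)
        spans⋃? []       w = w ≟ v
        spans⋃? (x ∷ xs) w = spans⋃? xs w ⊎-dec span? v x w

        v∈spans⋃ : ∀ xs → Spans⋃ xs v
        v∈spans⋃ []       = refl
        v∈spans⋃ (x ∷ xs) = inj₁ (v∈spans⋃ xs)

        ∈-spans⋃ : ∀ {xs x} → x ∈ᴸ xs → Spans⋃ xs x
        ∈-spans⋃ (here refl) = inj₂ (span-right v _)
        ∈-spans⋃ (there i)   = inj₁ (∈-spans⋃ i)

        spans⋃-module : ∀ xs → Module (Spans⋃ xs)
        spans⋃-module []       = λ { _ refl refl → refl }
        spans⋃-module (x ∷ xs) =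
          module-∪ (spans⋃-module xs) (span-module v x) (v∈spans⋃ xs) (span-left v x)

        -- Start from `{v}` and add one proper span at a time; `modules-leave-gap` keeps the union
        -- proper.
        spans⋃-proper : ∀ {xs} → All Block xs → ∃ λ y → U y × ¬ Spans⋃ xs y
        spans⋃-proper [] = t , Ut , t≢v
        spans⋃-proper {x ∷ xs} ((_ , q , Uq , q∉) ∷ bs) with spans⋃-proper bs
        ... | p , Up , p∉ with modules-leave-gap (spans⋃? xs) (span? v x) (spans⋃-module xs)
                                 (span-module v x) Up p∉ Uq q∉
        ...   | y , Uy , y∉₁ , y∉₂ = y , Uy , λ { (inj₁ y∈) → y∉₁ y∈ ; (inj₂ y∈) → y∉₂ y∈ }

        block-proper : ∃ λ y → U y × ¬ Block y
        block-proper with spans⋃-proper (all-filter block? (allFin n))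
        ... | y , Uy , y∉ = y , Uy , λ By → y∉ (∈-spans⋃ (∈-filter⁺ block? (∈-allFin y) By))

        block-module : Module Block
        block-module {x} x∉ Ba Bb = trans (toV Ba) (sym (toV Bb))
          where
          toV : ∀ {a} → Block a → E x a ≡ E x v
          toV {a} (Ua , y , Uy , y∉) =
            span-module v a (λ x∈ → x∉ (span⊆ Ua x∈ , y , Uy , λ y∈ → y∉ (span-mono x∈ y∈)))
              (span-right v a) (span-left v a)

        -- A proper module around the block contains `v`, so with each of its points it contains the
        -- span of that point with `v`; this span misses the same vertex of `U`, which puts the
        -- point in the block.
        block-maximal : IsMaximalProperModule G U (toSubset block?)
        block-maximal =
          ( module-subset block? proj₁ v∈block block-module
          , let (y , Uy , y∉) = block-proper in y , Uy , y∉ ∘ ∈-toSubset⁻ block?) ,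
          λ M' (isMod , y , Uy , y∉) M⊆M' x x∈ → ∈-toSubset⁺ block?
            ( proj₁ isMod x x∈ , y , Uy
            , y∉ ∘ span-least (_∈? M') (subset-module isMod)
                     (M⊆M' v (∈-toSubset⁺ block? v∈block)) x∈)

    -- Agreement of the decomposition step with the order-theoretic layer.

    open Connectivity

    inD⇒next : ∀ {w} → InD G U v w → Next U w
    inD⇒next (inj₁ (_ , refl))                     = inj₁ refl
    inD⇒next (inj₂ (inj₁ (_ , disc , v~w)))        = disc⇒next true disc v~w
    inD⇒next (inj₂ (inj₂ (inj₁ (_ , disc , v~w)))) = disc⇒next false disc v~w
    inD⇒next (inj₂ (inj₂ (inj₂ (_ , ¬disc , ¬codisc , M , isMax , v∈ , w∈)))) =
      Prime.maximal⇒next (¬disc-both ¬disc ¬codisc) isMax v∈ w∈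

    next⇒inD : ∀ {w} → Next U w → InD G U v w
    next⇒inD {w} N with any? (λ t → U? t ×-dec ¬? (t ≟ v))
    ... | no single = inj₁ ((v , centre , only) , only w (next-⊆ N))
      where
      only : ∀ x → U x → x ≡ v
      only x Ux = decidable-stable (x ≟ v) λ x≢v → single (x , Ux , x≢v)
    ... | yes (t , Ut , t≢v) with disc? true | disc? false
    ...   | yes disc | _         = inj₂ (inj₁ ((t , v , Ut , centre , t≢v) , disc , next⇒conn true N))
    ...   | no _     | yes disc  =
      inj₂ (inj₂ (inj₁ ((t , v , Ut , centre , t≢v) , disc , next⇒conn false N)))
    ...   | no ¬disc | no ¬codisc = inj₂ (inj₂ (inj₂
      ( (t , v , Ut , centre , t≢v) , ¬disc , ¬codisc
      , toSubset block? , block-maximal Ut t≢v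
      , ∈-toSubset⁺ block? (v∈block Ut t≢v) , ∈-toSubset⁺ block? (next⇒block Ut t≢v N))))
      where open Prime (¬disc-both ¬disc ¬codisc)

    -- Next U is a strong module: it is contained in every span that leaves it.
    next-separated : ∀ {u w} → U u → ¬ Next U u → Next U w → Below v w u
    next-separated {u} {w} Uu ¬Nu Nw = go (next⇒inD Nw)
      where
      go : InD G U v w → Below v w u
      go (inj₁ ((s , Us , only) , _)) =
        contradiction (inj₁ (trans (only u Uu) (sym (only v centre)))) ¬Nu
      go (inj₂ (inj₁ (_ , disc , v~w))) =
        separated⇒below true Uu (¬Nu ∘ disc⇒next true disc) v~w
      go (inj₂ (inj₂ (inj₁ (_ , disc , v~w)))) =
        separated⇒below false Uu (¬Nu ∘ disc⇒next false disc) v~w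
      go (inj₂ (inj₂ (inj₂ (_ , ¬disc , ¬codisc , M , isMax , v∈ , w∈)))) =
        P.separated⇒below isMax v∈ Uu (λ u∈ → ¬Nu (P.maximal⇒next isMax v∈ u∈)) w∈
        where module P = Prime (¬disc-both ¬disc ¬codisc)

  -- Iteration of the step.

  D : ℕ → V G → Set
  D i = InDecomp G i v

  good : ∀ i → Good (D i)
  good zero = record { centre = tt ; U? = λ _ → yes tt ; mod = λ ¬tt → contradiction tt ¬tt }
  good (suc i) = record
    { centre = next⇒inD (inj₁ refl)
    ; U?     = λ w → map′ next⇒inD inD⇒next (next? w)
    ; mod    = λ x∉ a∈ b∈ → next-module (x∉ ∘ next⇒inD) (inD⇒next a∈) (inD⇒next b∈)
    }
    where open OneStep (good i)

  D-suc⁻ : ∀ i {w} → D (suc i) w → D i w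
  D-suc⁻ i w∈ = next-⊆ (inD⇒next w∈)
    where open OneStep (good i)

  -- Go back to the last layer that contains `u`; the following one is strong, and `w` still belongs
  -- to it.
  missing⇒below : ∀ i {u w} → ¬ D i u → D i w → Below v w u
  missing⇒below zero    u∉ _ = contradiction tt u∉
  missing⇒below (suc i) {u} u∉ w∈ with Good.U? (good i) u
  ... | no u∉'  = missing⇒below i u∉' (D-suc⁻ i w∈)
  ... | yes u∈ = next-separated u∈ (u∉ ∘ next⇒inD) (inD⇒next w∈)
    where open OneStep (good i)

  -- Some `u` in layer `i` lies above `a`. Were `b` outside that layer, `u` would be strictly
  -- between `a` and `b`. The vertex `v` is excluded because it stays in every layer, while its
  -- covers need not.
  cover-lowers : ∀ i {a b} → a ≢ v → Cover v a b → D (suc i) a → D i b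
  cover-lowers i {a} {b} a≢v (_ , tight) a∈ with OneStep.inD⇒next (good i) a∈
  ... | inj₁ a≡v            = contradiction a≡v a≢v
  ... | inj₂ (u , u∈ , a<u) =
    decidable-stable (Good.U? (good i) b) λ b∉ → tight (u , a<u , missing⇒below i b∉ u∈)

  below-raises : ∀ i {a b} → Below v a b → D i b → D (suc i) a
  below-raises i a<b b∈ = OneStep.next⇒inD (good i) (inj₂ (_ , b∈ , a<b))

-- Combinators for equivalences.

_⇔-⟨×⟩_ : ∀ {A B C D : Set} → A ⇔ B → C ⇔ D → (A × C) ⇔ (B × D)
f ⇔-⟨×⟩ g = mk⇔ (λ (a , c) → to f a , to g c) (λ (b , d) → from f b , from g d)

⇔-¬ : ∀ {A B : Set} → A ⇔ B → (¬ A) ⇔ (¬ B)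
⇔-¬ f = mk⇔ (_∘ from f) (_∘ to f)

⇔-∃ : ∀ {A : Set} {P Q : A → Set} → (∀ a → P a ⇔ Q a) → ∃ P ⇔ ∃ Q
⇔-∃ f = mk⇔ (λ (a , p) → a , to (f a) p) (λ (a , q) → a , from (f a) q)

private
  variable
    s m : ℕ

-- The formulas.

sameTypeF : Fin s → Fin s → Fin s → Formula s m
sameTypeF a b d = or (and (edge a b) (and (edge a d) (neg (edge b d))))
                     (and (neg (edge a b)) (and (neg (edge a d)) (edge b d)))

ΓF : Formula (2 ℕ.+ (2 ℕ.+ s)) (0 ℕ.+ (0 ℕ.+ m))
ΓF = or (and (eqS a d) (eqS b c)) (and (eqS a c) (sameTypeF a b d))
  where
  a = zero
  b = suc zero
  c = suc (suc zero)
  d = suc (suc (suc zero))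

spanF : Fin s → Fin s → Fin s → Formula s m
spanF v u x = exS (stc 2 0 ΓF (suc v ∷ suc u ∷ []) [] (suc x ∷ zero ∷ []) [])

belowF : Fin s → Fin s → Fin s → Formula s m
belowF v a b = and (spanF v b a) (neg (spanF v a b))

coverF : Fin s → Fin s → Fin s → Formula s m
coverF v a b = and (belowF v a b)
  (neg (exS (and (belowF (suc v) (suc a) zero) (belowF (suc v) zero (suc b)))))

isSucF : Fin m → Fin m → Formula s m
isSucF p q = and (neg (leN p q)) (neg (exN (and (neg (leN (suc p) zero)) (neg (leN zero (suc q))))))

isZeroF : Fin m → Formula s m
isZeroF q = neg (exN (neg (leN (suc q) zero)))

stepF : Fin s → Formula (1 ℕ.+ (1 ℕ.+ s)) (1 ℕ.+ (1 ℕ.+ m))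
stepF v = and (neg (eqS zero (suc (suc v))))
  (and (coverF (suc (suc v)) zero (suc zero)) (isSucF zero (suc zero)))

-- The case `z` equal to `x` stands apart because no forward step leaves `x`. Otherwise a path has
-- to bring the number down to 0, where the layer is all of `V` and the final vertex is arbitrary.
decompF : Formula 2 1
decompF = or (eqS z x) (exS (exN (and (isZeroF zero)
  (stc 1 1 (stepF (suc x)) (suc z ∷ []) (suc zero ∷ []) (zero ∷ []) (zero ∷ [])))))
  where
  x z : Fin 2
  x = zero
  z = suc zero

-- Correctness of the formulas.

module Semantics (G : Graph) where
  open Graph G
  open Spans G

  spanF-correct : ∀ (σ : Vec (V G) s) (τ : Vec (Num G) m) v u x →
    Sat G (spanF v u x) σ τ ⇔ Span (lookup σ v) (lookup σ u) (lookup σ x)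
  spanF-correct σ τ v u x = ⇔-∃ λ y →
    mk⇔ (Star.gmap unpack (decode y)) (Star.gmap (λ (a , b) → (a ∷ b ∷ [] , [])) fwd)
    where
    unpack : Vec (V G) 2 × Vec (Num G) 0 → V G × V G
    unpack (a ∷ b ∷ [] , _) = a , b
    ΓSat : V G → Vec (V G) 2 × Vec (Num G) 0 → Vec (V G) 2 × Vec (Num G) 0 → Set
    ΓSat y (a , p) (b , q) = Sat G ΓF (a ++ (b ++ (y ∷ σ))) (p ++ (q ++ τ))
    -- `Γ` is already symmetric, so the symmetric closure in the semantics of `stc` adds no pairs.
    decode : ∀ y {p q} → SymClosure (ΓSat y) p q → Γ (unpack p) (unpack q)
    decode y {a ∷ b ∷ [] , []} {c ∷ d ∷ [] , []} (fwd r) = r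
    decode y {a ∷ b ∷ [] , []} {c ∷ d ∷ [] , []} (bwd r) = Γ-sym r

  belowF-correct : ∀ (σ : Vec (V G) s) (τ : Vec (Num G) m) v a b →
    Sat G (belowF v a b) σ τ ⇔ Below (lookup σ v) (lookup σ a) (lookup σ b)
  belowF-correct σ τ v a b = spanF-correct σ τ v b a ⇔-⟨×⟩ ⇔-¬ (spanF-correct σ τ v a b)

  coverF-correct : ∀ (σ : Vec (V G) s) (τ : Vec (Num G) m) v a b →
    Sat G (coverF v a b) σ τ ⇔ Cover (lookup σ v) (lookup σ a) (lookup σ b)
  coverF-correct σ τ v a b = belowF-correct σ τ v a b ⇔-⟨×⟩ ⇔-¬ (⇔-∃ λ y →
    belowF-correct (y ∷ σ) τ (suc v) (suc a) zero ⇔-⟨×⟩ belowF-correct (y ∷ σ) τ (suc v) zero (suc b))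

  isSucF-correct : ∀ (σ : Vec (V G) s) (τ : Vec (Num G) m) p q →
    Sat G (isSucF p q) σ τ ⇔ (toℕ (lookup τ p) ≡ suc (toℕ (lookup τ q)))
  isSucF-correct σ τ p q = mk⇔
    (λ (p≰q , no-between) → ℕ.≤-antisym
      (ℕ.≮⇒≥ λ 1+q<p →
        -- The number between is `q + 1`, which is in range because it is smaller than `p`.
        let r<  = ℕ.<-trans 1+q<p (toℕ<n (lookup τ p))
            r≡  = toℕ-fromℕ< r<
        in no-between (fromℕ< r<
          , (λ p≤r → ℕ.<⇒≱ 1+q<p (subst (toℕ (lookup τ p) ℕ.≤_) r≡ p≤r))
          , (λ r≤q → ℕ.1+n≰n (subst (ℕ._≤ toℕ (lookup τ q)) r≡ r≤q))))
      (ℕ.≰⇒> p≰q))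
    (λ p≡1+q →
      (λ p≤q → ℕ.1+n≰n (subst (ℕ._≤ toℕ (lookup τ q)) p≡1+q p≤q)) ,
      λ (r , p≰r , r≰q) → p≰r (subst (ℕ._≤ toℕ r) (sym p≡1+q) (ℕ.≰⇒> r≰q)))

  isZeroF-correct : ∀ (σ : Vec (V G) s) (τ : Vec (Num G) m) q →
    Sat G (isZeroF q) σ τ ⇔ (toℕ (lookup τ q) ≡ 0)
  isZeroF-correct σ τ q = mk⇔
    (λ least → ℕ.n≤0⇒n≡0 (decidable-stable (_ ℕ.≤? 0) λ q≰0 → least (zero , q≰0)))
    (λ q≡0 (r , q≰r) → q≰r (subst (ℕ._≤ toℕ r) (sym q≡0) z≤n))

  StepRel : V G → V G × Num G → V G × Num G → Set
  StepRel v (a , p) (b , q) = a ≢ v × Cover v a b × toℕ p ≡ suc (toℕ q)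

  stepF-correct : ∀ (σ : Vec (V G) s) (τ : Vec (Num G) m) v a b p q →
    Sat G (stepF v) (a ∷ b ∷ σ) (p ∷ q ∷ τ) ⇔ StepRel (lookup σ v) (a , p) (b , q)
  stepF-correct σ τ v a b p q = mk⇔ id id ⇔-⟨×⟩
    (coverF-correct (a ∷ b ∷ σ) (p ∷ q ∷ τ) (suc (suc v)) zero (suc zero)
     ⇔-⟨×⟩ isSucF-correct (a ∷ b ∷ σ) (p ∷ q ∷ τ) zero (suc zero))

  -- Layer membership along numbered chains.

  module _ (v : V G) where
    open Layers G v

    Path : V G × Num G → V G × Num G → Set
    Path = Star (SymClosure (StepRel v))

    step-invariant : ∀ {a p b q} → StepRel v (a , p) (b , q) → D (toℕ p) a ⇔ D (toℕ q) b
    step-invariant {q = q} (a≢v , cov , p≡1+q) rewrite p≡1+q =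
      mk⇔ (cover-lowers (toℕ q) a≢v cov) (below-raises (toℕ q) (proj₁ cov))

    -- Membership is carried back from the end of the path. Steps may be traversed either way, which
    -- is why the invariant of a single step must be an equivalence.
    path-invariant : ∀ {a p b q} → Path (a , p) (b , q) → D (toℕ q) b → D (toℕ p) a
    path-invariant ε           b∈ = b∈
    path-invariant (fwd r ◅ s) b∈ = from (step-invariant r) (path-invariant s b∈)
    path-invariant (bwd r ◅ s) b∈ = to (step-invariant r) (path-invariant s b∈)

    descend : ∀ {i w} (p : Num G) → toℕ p ≡ i → w ≢ v → D i w → ∃ λ t → Path (w , p) (t , zero)
    descend {zero}  {w} zero    _  _   _  = w , ε
    descend {suc i} {w} (suc p) p≡ w≢v w∈ with OneStep.inD⇒next (good i) w∈
    ... | inj₁ w≡v            = contradiction w≡v w≢v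
    ... | inj₂ (u , _ , w<u) with exists-cover w<u
    -- The vertex `u` only ensures that a cover exists. The cover `c` is not `v`, as nothing lies
    -- below `v`, so the descent can continue; `inject₁` keeps the value of `p` inside the same
    -- number sort.
    ...   | c , cov with descend (inject₁ p) (trans (toℕ-inject₁ p) (ℕ.suc-injective p≡))
                           (λ { refl → ¬below-bottom (proj₁ cov) }) (cover-lowers i w≢v cov w∈)
    ...     | t , path = t , fwd (w≢v , cov , cong suc (sym (toℕ-inject₁ p))) ◅ path

  decompF-correct : ∀ (i : Num G) (v w : V G) →
    Sat G decompF (v ∷ w ∷ []) (i ∷ []) ⇔ InDecomp G (toℕ i) v w
  decompF-correct i v w = mk⇔ sound complete
    where
    open Layers G v

    unpack : Vec (V G) 1 × Vec (Num G) 1 → V G × Num G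
    unpack (a ∷ [] , p ∷ []) = a , p

    pack : V G × Num G → Vec (V G) 1 × Vec (Num G) 1
    pack (a , p) = a ∷ [] , p ∷ []

    StepSat : V G → Num G → Vec (V G) 1 × Vec (Num G) 1 → Vec (V G) 1 × Vec (Num G) 1 → Set
    StepSat t q (a , p) (b , r) =
      Sat G (stepF (suc zero)) (a ++ (b ++ (t ∷ v ∷ w ∷ []))) (p ++ (r ++ (q ∷ i ∷ [])))

    sound : Sat G decompF (v ∷ w ∷ []) (i ∷ []) → D (toℕ i) w
    sound (inj₁ refl) = Good.centre (good (toℕ i))
    sound (inj₂ (t , q , q=0 , path)) =
      -- At number 0 the layer condition on the final vertex is trivially true.
      path-invariant v (Star.gmap unpack decode path) (subst (λ j → D j t) (sym q≡0) tt)
      where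
      q≡0 = to (isZeroF-correct (t ∷ v ∷ w ∷ []) (q ∷ i ∷ []) zero) q=0
      decode : ∀ {x y} → SymClosure (StepSat t q) x y → SymClosure (StepRel v) (unpack x) (unpack y)
      decode {a ∷ [] , p ∷ []} {b ∷ [] , q' ∷ []} (fwd r) =
        fwd (to (stepF-correct (t ∷ v ∷ w ∷ []) (q ∷ i ∷ []) (suc zero) a b p q') r)
      decode {a ∷ [] , p ∷ []} {b ∷ [] , q' ∷ []} (bwd r) =
        bwd (to (stepF-correct (t ∷ v ∷ w ∷ []) (q ∷ i ∷ []) (suc zero) b a q' p) r)

    complete : D (toℕ i) w → Sat G decompF (v ∷ w ∷ []) (i ∷ [])
    complete w∈ with w ≟ v
    ... | yes w≡v = inj₁ w≡v
    ... | no w≢v with descend v i refl w≢v w∈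
    ...   | t , path = inj₂ (t , zero ,
              from (isZeroF-correct (t ∷ v ∷ w ∷ []) (zero ∷ i ∷ []) zero) refl ,
              Star.gmap pack encode path)
      where
      encode : ∀ {x y} → SymClosure (StepRel v) x y → SymClosure (StepSat t zero) (pack x) (pack y)
      encode {a , p} {b , q} (fwd r) =
        fwd (from (stepF-correct (t ∷ v ∷ w ∷ []) (zero ∷ i ∷ []) (suc zero) a b p q) r)
      encode {a , p} {b , q} (bwd r) =
        bwd (from (stepF-correct (t ∷ v ∷ w ∷ []) (zero ∷ i ∷ []) (suc zero) b a q p) r)

theorem3p16 : Σ (Formula 2 1) λ φD →
    ∀ (G : Graph) (i : Num G) (v w : V G) →
    Sat G φD (v ∷ w ∷ []) (i ∷ []) ⇔ InDecomp G (toℕ i) v w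
theorem3p16 = decompF , Semantics.decompF-correct
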